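{- Let $\mathcal{A}=\{A_1,\dots,A_m\}$ be a bimodal collection of pairwise disjoint subsets of a finite abelian group $G$. Suppose that for some $i$ the set $A_i$ is a coset of its internal difference group $H_i$. Let $A_i^1,\dots,A_i^r$ be pairwise disjoint subsets whose union is $A_i$, with internal difference groups $H_i^1,\dots,H_i^r$ respectively, such that for each $j=1,\dots,r$ the set $A_i^j$ is a coset of $H_i^j$. Then the collection $\{A_1,\dots,A_{i-1},A_i^1,\dots,A_i^r,A_{i+1},\dots,A_m\}$ has the bimodal property.
   Context: $G$ is a finite abelian group written additively. The internal difference group of a subset $S\subseteq G$ is the subgroup of $G$ generated by all elements $x-y$ with $x,y\in S$. A collection $\{A_1,\dots,A_m\}$ of pairwise disjoint subsets of $G$ is bimodal (has the bimodal property) if for every $i$ and every $\delta\in G\setminus\{0\}$, the number $N_i(\delta)$ of pairs $(a,b)$ with $a\in A_i$, $b\in A_j$ for some $j\neq i$, and $a-b=\delta$, satisfies $N_i(\delta)\in\{0,|A_i|\}$. -}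

module Defs where

open import Algebra.Bundles using (AbelianGroup)
open import Data.Fin.Base using (Fin; toℕ)
open import Data.Fin.Properties using (any?) renaming (_≟_ to _≟ꟳ_)
open import Data.Fin.Subset using (Subset; Empty; _∩_; ∣_∣) renaming (_∈_ to _∈ꟳ_)
open import Data.Fin.Subset.Properties using () renaming (_∈?_ to _∈ꟳ?_)
open import Data.List.Base
  using (List; length; lookup; tabulate; filter; cartesianProduct; take; drop; _++_)
open import Data.List.Relation.Unary.AllPairs using (AllPairs)
open import Data.Nat.Base using (ℕ; suc)
open import Data.Product.Base using (_×_; _,_; ∃; ∃₂)
open import Data.Sum.Base using (_⊎_)
open import Function.Bundles using (Inverse; _⇔_)
open import Function.Properties.Inverse using (Inverse⇒Injection)
open import Level using (Level; _⊔_) renaming (suc to lsuc)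
open import Relation.Binary.Definitions using (Decidable)
open import Relation.Binary.PropositionalEquality using (_≡_; _≢_; setoid)
open import Relation.Nullary.Decidable using (Dec; _×-dec_; ¬?; via-injection)
open import Relation.Unary using (Pred)

record FiniteAbelianGroup c ℓ : Set (lsuc (c ⊔ ℓ)) where
  field
    abelianGroup : AbelianGroup c ℓ
    order        : ℕ
    enumeration  : Inverse (AbelianGroup.setoid abelianGroup) (setoid (Fin order))

  open AbelianGroup abelianGroup public
    renaming (_∙_ to infixl 6 _+_; ε to 0#; _⁻¹ to -_)
    using (Carrier; _≈_; _≉_)
  open Inverse enumeration public
    using () renaming (to to index; from to element)

  infixl 6 _-_
  _-_ : Carrier → Carrier → Carrier
  x - y = x + (- y)

module _ {c ℓ : Level} (G : FiniteAbelianGroup c ℓ) where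
  open FiniteAbelianGroup G

  -- Subsets of G are encoded along the enumeration, which makes membership
  -- decidable and ∣_∣ the cardinality.
  SubsetOf : Set
  SubsetOf = Subset order

  infix 4 _∈_
  _∈_ : Carrier → SubsetOf → Set
  x ∈ A = index x ∈ꟳ A

  data Generated {p} (S : Pred Carrier p) : Pred Carrier (c ⊔ ℓ ⊔ p) where
    generator : ∀ {x} → S x → Generated S x
    zero      : Generated S 0#
    add       : ∀ {x y} → Generated S x → Generated S y → Generated S (x + y)
    negate    : ∀ {x} → Generated S x → Generated S (- x)
    respects  : ∀ {x y} → x ≈ y → Generated S x → Generated S y

  Differences : SubsetOf → Pred Carrier (c ⊔ ℓ)
  Differences A d = ∃₂ λ x y → x ∈ A × y ∈ A × d ≈ x - y

  InternalDifferenceGroup : SubsetOf → Pred Carrier (c ⊔ ℓ)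
  InternalDifferenceGroup A = Generated (Differences A)

  IsCosetOf : ∀ {p} → SubsetOf → Pred Carrier p → Set (c ⊔ ℓ ⊔ p)
  IsCosetOf A H = ∃ λ g → ∀ x → (x ∈ A) ⇔ (∃ λ h → H h × x ≈ g + h)

  PairwiseDisjoint : List SubsetOf → Set
  PairwiseDisjoint = AllPairs (λ A B → Empty (A ∩ B))

  InOther : (𝒜 : List SubsetOf) → Fin (length 𝒜) → Carrier → Set
  InOther 𝒜 i b = ∃ λ j → j ≢ i × b ∈ lookup 𝒜 j

  DifferencePair : (𝒜 : List SubsetOf) → Fin (length 𝒜) → Carrier →
                   Pred (Carrier × Carrier) ℓ
  DifferencePair 𝒜 i δ (a , b) = a ∈ lookup 𝒜 i × InOther 𝒜 i b × a - b ≈ δ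

  _≈?_ : Decidable _≈_
  _≈?_ = via-injection (Inverse⇒Injection enumeration) _≟ꟳ_

  differencePair? : ∀ 𝒜 i δ ab → Dec (DifferencePair 𝒜 i δ ab)
  differencePair? 𝒜 i δ (a , b) =
    (index a ∈ꟳ? lookup 𝒜 i)
      ×-dec any? (λ j → ¬? (j ≟ꟳ i) ×-dec (index b ∈ꟳ? lookup 𝒜 j))
      ×-dec ((a - b) ≈? δ)

  -- Lists each element of G exactly once up to _≈_.
  elements : List Carrier
  elements = tabulate element

  -- N 𝒜 i δ is Nᵢ(δ).
  N : (𝒜 : List SubsetOf) → Fin (length 𝒜) → Carrier → ℕ
  N 𝒜 i δ = length (filter (differencePair? 𝒜 i δ) (cartesianProduct elements elements))

  record Bimodal (𝒜 : List SubsetOf) : Set (c ⊔ ℓ) where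
    field
      disjoint : PairwiseDisjoint 𝒜
      bimodal  : ∀ i δ → δ ≉ 0# → N 𝒜 i δ ≡ 0 ⊎ N 𝒜 i δ ≡ ∣ lookup 𝒜 i ∣

  -- The i-th member is replaced by the (possibly several) members of ℬ.
  refine : (𝒜 : List SubsetOf) → Fin (length 𝒜) → List SubsetOf → List SubsetOf
  refine 𝒜 i ℬ = take (toℕ i) 𝒜 ++ ℬ ++ drop (suc (toℕ i)) 𝒜

{-# OPTIONS --safe #-}

-- For pairwise disjoint 𝒜, bimodality says that for each member A the set
-- ⋃ 𝒜 ∖ A is stable under translation by differences of elements of A: Nᵢ(δ)
-- counts the a ∈ Aᵢ with a - δ ∈ ⋃ 𝒜 ∖ Aᵢ, so it is 0 or ∣ Aᵢ ∣ exactly when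
-- this holds for no a or for all a.  This criterion depends on 𝒜 only through
-- ⋃ 𝒜, which refining a member does not change.  For a new member B ⊆ A, split
-- ⋃ 𝒜 ∖ B into ⋃ 𝒜 ∖ A, which is stable under the differences of A, and A ∖ B,
-- which is stable because A and B are cosets of groups containing the
-- differences of B.
module Submission where

open import Defs
open import Algebra.Bundles using (AbelianGroup)
import Algebra.Properties.AbelianGroup as AbelianGroupProperties
open import Data.Bool.Base using (true)
open import Data.Empty using (⊥-elim)
open import Data.Fin.Base using (Fin; zero; suc)
open import Data.Fin.Properties using (any?) renaming (_≟_ to _≟ꟳ_)
open import Data.Fin.Subset using (Subset; ⋃; Empty; _∩_; _∪_; _⊆_; ∣_∣; ⁅_⁆; inside; outside)
  renaming (_∈_ to _∈ꟳ_; _∉_ to _∉ꟳ_; ⊥ to ∅)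
open import Data.Fin.Subset.Properties
  using (x∈p∩q⁺; x∈p∩q⁻; x∈p∪q⁺; x∈p∪q⁻; ∉⊥; drop-there; x∈⁅x⁆; x∈⁅y⁆⇒x≡y; ∣⁅x⁆∣≡1;
         ∣⊥∣≡0; Empty-unique; nonempty?; ⊆-antisym; p⊂q⇒∣p∣<∣q∣; ∪-assoc; ∪-identityˡ)
  renaming (_∈?_ to _∈ꟳ?_)
open import Data.List.Base
  using (List; []; _∷_; length; lookup; map; tabulate; filter; cartesianProduct; _++_)
open import Data.List.Properties
  using (filter-++; filter-accept; filter-reject; length-++; map-tabulate; tabulate-lookup)
open import Data.List.Membership.Propositional.Properties using (∈-lookup)
open import Data.List.Relation.Unary.All as All using (All; []; _∷_)
import Data.List.Relation.Unary.All.Properties as Allₚ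
open import Data.List.Relation.Unary.AllPairs using (AllPairs; []; _∷_)
import Data.List.Relation.Unary.AllPairs.Properties as AllPairsₚ
open import Data.Nat.Base using (ℕ; suc; _+_)
open import Data.Nat.Properties using (<⇒≢)
open import Data.Product.Base using (_×_; _,_; ∃; proj₁; proj₂)
open import Data.Sum.Base using (_⊎_; inj₁; inj₂)
import Data.Vec.Base as Vec
import Data.Vec.Properties as Vecₚ
open import Function.Base using (_∘_)
open import Function.Bundles using (_⇔_; mk⇔; Equivalence; Inverse)
open import Relation.Binary.Core using (Rel)
open import Relation.Binary.Definitions using (Symmetric)
open import Relation.Binary.PropositionalEquality
  using (_≡_; _≢_; refl; sym; trans; cong; cong₂; subst; module ≡-Reasoning)
import Relation.Binary.Reasoning.Setoid as SetoidReasoning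
open import Relation.Nullary using (¬_; Dec; yes; no; does)
open import Relation.Nullary.Decidable using (dec-true; _×-dec_; ¬?; decidable-stable)
open import Relation.Unary using (Pred; Decidable)

private
  variable
    n : ℕ

-- Cardinalities of decidable subsets and counting in products.

comprehension : ∀ {p} {P : Pred (Fin n) p} → Decidable P →
                ∃ λ (V : Subset n) → ∀ k → k ∈ꟳ V ⇔ P k
comprehension {P = P} P? = V , λ k → mk⇔
  (λ k∈V → witness (P? k) (trans (sym (lookup-V k)) (Vecₚ.[]=⇒lookup k∈V)))
  (λ pk → Vecₚ.lookup⇒[]= k V (trans (lookup-V k) (dec-true (P? k) pk)))
  where
  V = Vec.tabulate (does ∘ P?)

  lookup-V : ∀ k → Vec.lookup V k ≡ does (P? k)
  lookup-V = Vecₚ.lookup∘tabulate (does ∘ P?)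

  witness : ∀ {q} {Q : Set q} (Q? : Dec Q) → does Q? ≡ true → Q
  witness (yes q) _ = q

module _ {a p} {A : Set a} {P : Pred A p} (P? : Decidable P) where

  length-filter-tabulate : (f : Fin n → A) (V : Subset n) → (∀ k → k ∈ꟳ V ⇔ P (f k)) →
                           length (filter P? (tabulate f)) ≡ ∣ V ∣
  length-filter-tabulate f Vec.[] V⇔P = refl
  length-filter-tabulate f (inside Vec.∷ V) V⇔P =
    trans (cong length (filter-accept P? (to (V⇔P zero) Vec.here)))
          (cong suc (length-filter-tabulate (f ∘ suc) V λ k →
            mk⇔ (to (V⇔P (suc k)) ∘ Vec.there) (drop-there ∘ from (V⇔P (suc k)))))
    where open Equivalence
  length-filter-tabulate f (outside Vec.∷ V) V⇔P =
    trans (cong length (filter-reject P? (zero∉ ∘ from (V⇔P zero))))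
          (length-filter-tabulate (f ∘ suc) V λ k →
            mk⇔ (to (V⇔P (suc k)) ∘ Vec.there) (drop-there ∘ from (V⇔P (suc k))))
    where
    open Equivalence
    zero∉ : zero ∉ꟳ outside Vec.∷ V
    zero∉ ()

module _ {a b p} {A : Set a} {B : Set b} {P : Pred (A × B) p} (P? : Decidable P) where

  -- P is the graph of φ restricted to V.
  length-filter-cartesianProduct :
    ∀ {m} (f : Fin m → A) (g : Fin n → B) (V : Subset m) (φ : Fin m → Fin n) →
    (∀ k l → P (f k , g l) ⇔ (k ∈ꟳ V × l ≡ φ k)) →
    length (filter P? (cartesianProduct (tabulate f) (tabulate g))) ≡ ∣ V ∣
  length-filter-cartesianProduct f g Vec.[] φ P⇔graph = refl
  length-filter-cartesianProduct {n = n} f g (s Vec.∷ V) φ P⇔graph = begin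
    length (filter P? (row ++ rows))
      ≡⟨ cong length (filter-++ P? row rows) ⟩
    length (filter P? row ++ filter P? rows)
      ≡⟨ length-++ (filter P? row) ⟩
    length (filter P? row) + length (filter P? rows)
      ≡⟨ cong₂ _+_ (count-row s P⇔graph) count-rows ⟩
    ∣ fibre s ∣ + ∣ V ∣
      ≡⟨ ∣∷∣ s ⟩
    ∣ s Vec.∷ V ∣ ∎
    where
    open ≡-Reasoning
    open Equivalence
    row  = map (f zero ,_) (tabulate g)
    rows = cartesianProduct (tabulate (f ∘ suc)) (tabulate g)

    -- Each row of a graph contributes at most one match, the value of `φ`. The bit `t` is an
    -- argument so that the product is split into `row` and `rows` once for both values.
    fibre : ∀ t → Subset n
    fibre inside  = ⁅ φ zero ⁆
    fibre outside = ∅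

    ∣∷∣ : ∀ t → ∣ fibre t ∣ + ∣ V ∣ ≡ ∣ t Vec.∷ V ∣
    ∣∷∣ inside  = cong (_+ ∣ V ∣) (∣⁅x⁆∣≡1 (φ zero))
    ∣∷∣ outside = cong (_+ ∣ V ∣) (∣⊥∣≡0 n)

    count-rows : length (filter P? rows) ≡ ∣ V ∣
    count-rows = length-filter-cartesianProduct (f ∘ suc) g V (φ ∘ suc) λ k l → mk⇔
      (λ p → let k∈ , l≡ = to (P⇔graph (suc k) l) p in drop-there k∈ , l≡)
      (λ (k∈ , l≡) → from (P⇔graph (suc k) l) (Vec.there k∈ , l≡))

    fibre⇔ : ∀ t → (∀ k l → P (f k , g l) ⇔ (k ∈ꟳ t Vec.∷ V × l ≡ φ k)) →
             ∀ l → l ∈ꟳ fibre t ⇔ P (f zero , g l)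
    fibre⇔ inside  eqv l = mk⇔
      (λ l∈ → from (eqv zero l) (Vec.here , x∈⁅y⁆⇒x≡y (φ zero) l∈))
      (λ p → subst (_∈ꟳ ⁅ φ zero ⁆) (sym (proj₂ (to (eqv zero l) p))) (x∈⁅x⁆ (φ zero)))
    fibre⇔ outside eqv l = mk⇔ (⊥-elim ∘ ∉⊥) (⊥-elim ∘ zero∉ ∘ proj₁ ∘ to (eqv zero l))
      where
      zero∉ : zero ∉ꟳ outside Vec.∷ V
      zero∉ ()

    count-row : ∀ t → (∀ k l → P (f k , g l) ⇔ (k ∈ꟳ t Vec.∷ V × l ≡ φ k)) →
                length (filter P? row) ≡ ∣ fibre t ∣
    count-row t eqv = trans (cong (length ∘ filter P?) (map-tabulate g (f zero ,_)))
      (length-filter-tabulate P? (λ l → f zero , g l) (fibre t) (fibre⇔ t eqv))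

-- Inclusion, unions and disjointness of finite subsets.

p⊆q∧∣p∣≡∣q∣⇒q⊆p : {p q : Subset n} → p ⊆ q → ∣ p ∣ ≡ ∣ q ∣ → q ⊆ p
p⊆q∧∣p∣≡∣q∣⇒q⊆p {p = p} p⊆q eq {x} x∈q = decidable-stable (x ∈ꟳ? p) λ x∉p →
  <⇒≢ (p⊂q⇒∣p∣<∣q∣ (p⊆q , x , x∈q , x∉p)) eq

∈⋃⁻ : (𝒜 : List (Subset n)) {x : Fin n} → x ∈ꟳ ⋃ 𝒜 → ∃ λ j → x ∈ꟳ lookup 𝒜 j
∈⋃⁻ []      x∈ = ⊥-elim (∉⊥ x∈)
∈⋃⁻ (A ∷ 𝒜) x∈ with x∈p∪q⁻ A (⋃ 𝒜) x∈
... | inj₁ x∈A = zero , x∈A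
... | inj₂ x∈⋃ = let j , x∈Aⱼ = ∈⋃⁻ 𝒜 x∈⋃ in suc j , x∈Aⱼ

∈⋃⁺ : (𝒜 : List (Subset n)) {x : Fin n} (j : Fin (length 𝒜)) → x ∈ꟳ lookup 𝒜 j → x ∈ꟳ ⋃ 𝒜
∈⋃⁺ (A ∷ 𝒜) zero    x∈A = x∈p∪q⁺ (inj₁ x∈A)
∈⋃⁺ (A ∷ 𝒜) (suc j) x∈  = x∈p∪q⁺ {p = A} (inj₂ (∈⋃⁺ 𝒜 j x∈))

⋃≡⇒lookup⊆ : (𝒜 : List (Subset n)) {A : Subset n} → ⋃ 𝒜 ≡ A → ∀ j → lookup 𝒜 j ⊆ A
⋃≡⇒lookup⊆ 𝒜 refl j = ∈⋃⁺ 𝒜 j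

⋃-++ : (𝒜 ℬ : List (Subset n)) → ⋃ (𝒜 ++ ℬ) ≡ ⋃ 𝒜 ∪ ⋃ ℬ
⋃-++ []      ℬ = sym (∪-identityˡ (⋃ ℬ))
⋃-++ (A ∷ 𝒜) ℬ = trans (cong (A ∪_) (⋃-++ 𝒜 ℬ)) (sym (∪-assoc A (⋃ 𝒜) (⋃ ℬ)))

Empty-∩-sym : Symmetric (λ (A B : Subset n) → Empty (A ∩ B))
Empty-∩-sym {x = A} {y = B} A∩B=∅ (k , k∈) =
  let k∈B , k∈A = x∈p∩q⁻ B A k∈ in A∩B=∅ (k , x∈p∩q⁺ (k∈A , k∈B))

Empty-∩-monoˡ : {A B C : Subset n} → A ⊆ B → Empty (B ∩ C) → Empty (A ∩ C)
Empty-∩-monoˡ {A = A} {C = C} A⊆B B∩C=∅ (k , k∈) =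
  let k∈A , k∈C = x∈p∩q⁻ A C k∈ in B∩C=∅ (k , x∈p∩q⁺ (A⊆B k∈A , k∈C))

Empty-∩-monoʳ : {A B C : Subset n} → B ⊆ C → Empty (A ∩ C) → Empty (A ∩ B)
Empty-∩-monoʳ B⊆C = Empty-∩-sym ∘ Empty-∩-monoˡ B⊆C ∘ Empty-∩-sym

-- Access to list predicates by position.

module _ {a} {A : Set a} where

  All-fromLookup : ∀ {p} {P : Pred A p} {xs} → (∀ i → P (lookup xs i)) → All P xs
  All-fromLookup {P = P} {xs} p = subst (All P) (tabulate-lookup xs) (Allₚ.tabulate⁺ p)

  All-lookup : ∀ {p} {P : Pred A p} {xs} → All P xs → ∀ i → P (lookup xs i)
  All-lookup ps i = All.lookup ps (∈-lookup i)

  -- `AllPairs` relates only earlier entries to later ones; symmetry of `R` covers the positions in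
  -- reversed order.
  AllPairs-lookup : ∀ {r} {R : Rel A r} {xs} → Symmetric R → AllPairs R xs →
                    ∀ {i j} → i ≢ j → R (lookup xs i) (lookup xs j)
  AllPairs-lookup R-sym (r ∷ rs) {zero}  {zero}  i≢j = ⊥-elim (i≢j refl)
  AllPairs-lookup R-sym (r ∷ rs) {zero}  {suc j} i≢j = All-lookup r j
  AllPairs-lookup R-sym (r ∷ rs) {suc i} {zero}  i≢j = R-sym (All-lookup r i)
  AllPairs-lookup R-sym (r ∷ rs) {suc i} {suc j} i≢j = AllPairs-lookup R-sym rs (i≢j ∘ cong suc)

-- Translations, cosets and stability in the group.

module _ {c ℓ} (G : FiniteAbelianGroup c ℓ) where
  open FiniteAbelianGroup G using (abelianGroup; order; enumeration; element; index; _≈_; _-_; -_)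
    renaming (_+_ to infixl 6 _⊹_)
  private
    _∈ᴳ_ = _∈_ G
    infix 4 _∈ᴳ_
  open AbelianGroup abelianGroup using (Carrier; ε; setoid; assoc; comm; ∙-congˡ; ∙-congʳ; ⁻¹-cong)
    renaming (refl to ≈-refl; sym to ≈-sym; trans to ≈-trans)
  open AbelianGroupProperties abelianGroup
    using (⁻¹-anti-homo‿-; //-rightDividesʳ; x∙y⁻¹≈ε⇒x≈y)

  ∈-resp-≈ : ∀ {A x y} → x ≈ y → x ∈ᴳ A → y ∈ᴳ A
  ∈-resp-≈ {A} x≈y = subst (_∈ꟳ A) (Inverse.to-cong enumeration x≈y)

  element-index : ∀ x → element (index x) ≈ x
  element-index = Inverse.strictlyInverseʳ enumeration

  index-element : ∀ k → index (element k) ≡ k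
  index-element = Inverse.strictlyInverseˡ enumeration

  -- This links counting to translation: if `b` is the partner of `a` for the difference `a - b`,
  -- then the partner of `a′` for the same difference is `b` translated by `a′ - a`.
  a′-[a-b] : ∀ a a′ b → a′ - (a - b) ≈ b ⊹ (a′ - a)
  a′-[a-b] a a′ b = begin
    a′ - (a - b)  ≈⟨ ∙-congˡ (⁻¹-anti-homo‿- a b) ⟩
    a′ ⊹ (b - a)  ≈⟨ assoc a′ b (- a) ⟨
    a′ ⊹ b - a    ≈⟨ ∙-congʳ (comm a′ b) ⟩
    b ⊹ a′ - a    ≈⟨ assoc b a′ (- a) ⟩
    b ⊹ (a′ - a)  ∎
    where open SetoidReasoning setoid

  a-[a-b]≈b : ∀ a b → a - (a - b) ≈ b
  a-[a-b]≈b a b = begin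
    a - (a - b)  ≈⟨ a′-[a-b] a a b ⟩
    b ⊹ (a - a)  ≈⟨ assoc b a (- a) ⟨
    b ⊹ a - a    ≈⟨ //-rightDividesʳ a b ⟩
    b            ∎
    where open SetoidReasoning setoid

  -‿cong : ∀ {a x y} → x ≈ y → a - x ≈ a - y
  -‿cong x≈y = ∙-congˡ (⁻¹-cong x≈y)

  coset-absorbs : ∀ {p} {S : Pred Carrier p} {A} → IsCosetOf G A (Generated G S) →
                  ∀ {x d} → x ∈ᴳ A → Generated G S d → x ⊹ d ∈ᴳ A
  coset-absorbs (g , A⇔) {x} {d} x∈A d∈ with Equivalence.to (A⇔ x) x∈A
  ... | h , h∈ , x≈g+h = Equivalence.from (A⇔ (x ⊹ d))
    (h ⊹ d , add h∈ d∈ , ≈-trans (∙-congʳ x≈g+h) (assoc g h d))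

  -- Only single differences `a′ - a` occur, not the group they generate, since comparing the
  -- partners of two elements yields just these. `W` is a parameter so that a collection enters only
  -- through its union.
  Stable : SubsetOf G → SubsetOf G → Set c
  Stable W A = ∀ {a a′ b} → a ∈ᴳ A → a′ ∈ᴳ A → b ∈ᴳ W → ¬ b ∈ᴳ A →
               b ⊹ (a′ - a) ∈ᴳ W × ¬ b ⊹ (a′ - a) ∈ᴳ A

  -- Equivalence of bimodality and stability.

  module _ {𝒜 : List (SubsetOf G)} where

    InOther-resp-≈ : ∀ {i x y} → x ≈ y → InOther G 𝒜 i x → InOther G 𝒜 i y
    InOther-resp-≈ x≈y (j , j≢i , x∈) = j , j≢i , ∈-resp-≈ x≈y x∈

    InOther? : ∀ i x → Dec (InOther G 𝒜 i x)
    InOther? i x = any? λ j → ¬? (j ≟ꟳ i) ×-dec (index x ∈ꟳ? lookup 𝒜 j)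

    -- Disjointness keeps a point of another member out of the `i`-th one; conversely, a member
    -- containing a point outside the `i`-th has an index other than `i`. The indices `j` thereby
    -- disappear from the criterion.
    InOther⇔ : PairwiseDisjoint G 𝒜 → ∀ {i x} →
               InOther G 𝒜 i x ⇔ (x ∈ᴳ ⋃ 𝒜 × ¬ x ∈ᴳ lookup 𝒜 i)
    InOther⇔ disj {i} {x} = mk⇔
      (λ (j , j≢i , x∈Aⱼ) → ∈⋃⁺ 𝒜 j x∈Aⱼ , λ x∈Aᵢ →
        AllPairs-lookup Empty-∩-sym disj j≢i (index x , x∈p∩q⁺ (x∈Aⱼ , x∈Aᵢ)))
      (λ (x∈⋃ , x∉Aᵢ) → let j , x∈Aⱼ = ∈⋃⁻ 𝒜 x∈⋃ in
        j , (λ j≡i → x∉Aᵢ (subst (λ k → x ∈ᴳ lookup 𝒜 k) j≡i x∈Aⱼ)) , x∈Aⱼ)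

    module _ (i : Fin (length 𝒜)) (δ : Carrier) where

      Matched : Fin order → Set
      Matched k = k ∈ꟳ lookup 𝒜 i × InOther G 𝒜 i (element k - δ)

      matched : ∃ λ V → ∀ k → k ∈ꟳ V ⇔ Matched k
      matched = comprehension (λ k → (k ∈ꟳ? lookup 𝒜 i) ×-dec InOther? i (element k - δ))

      -- Solving `a - b ≈ δ` for `b` gives `b ≈ a - δ`, so the counted pairs form the graph of
      -- subtraction of `δ` over the matched elements.
      N≡∣matched∣ : ∀ V → (∀ k → k ∈ꟳ V ⇔ Matched k) → N G 𝒜 i δ ≡ ∣ V ∣
      N≡∣matched∣ V V⇔ = length-filter-cartesianProduct (differencePair? G 𝒜 i δ)
        element element V (λ k → index (element k - δ)) λ k l → mk⇔
        (λ (a∈ , b∈ , a-b≈δ) →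
          let b≈a-δ = ≈-trans (≈-sym (a-[a-b]≈b (element k) (element l))) (-‿cong a-b≈δ) in
          Equivalence.from (V⇔ k)
            (subst (_∈ꟳ lookup 𝒜 i) (index-element k) a∈ , InOther-resp-≈ b≈a-δ b∈) ,
          trans (sym (index-element l)) (Inverse.to-cong enumeration b≈a-δ))
        (λ { (k∈V , refl) →
          let k∈A , b∈ = Equivalence.to (V⇔ k) k∈V
              b≈ = element-index (element k - δ) in
          subst (_∈ꟳ lookup 𝒜 i) (sym (index-element k)) k∈A ,
          InOther-resp-≈ (≈-sym b≈) b∈ ,
          ≈-trans (-‿cong b≈) (a-[a-b]≈b (element k) δ) })

    -- For `δ = a - b` the pair `(a , b)` is counted, so the count is nonzero and must be the full
    -- cardinality. Hence `a′` is matched too, and its partner `a′ - δ` is the required translate of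
    -- `b`.
    bimodal⇒stable : Bimodal G 𝒜 → ∀ i → Stable (⋃ 𝒜) (lookup 𝒜 i)
    bimodal⇒stable bim i {a} {a′} {b} a∈ a′∈ b∈⋃ b∉ =
      Equivalence.to (InOther⇔ disjoint)
        (InOther-resp-≈ (≈-trans (∙-congʳ (element-index a′)) (a′-[a-b] a a′ b))
          (proj₂ (Equivalence.to (V⇔ (index a′)) (A⊆V a′∈))))
      where
      open Bimodal bim
      δ = a - b
      V = proj₁ (matched i δ)
      V⇔ : ∀ k → k ∈ꟳ V ⇔ Matched i δ k
      V⇔ = proj₂ (matched i δ)

      a∈V : a ∈ᴳ V
      a∈V = Equivalence.from (V⇔ (index a)) (a∈ ,
        InOther-resp-≈ (≈-sym (≈-trans (∙-congʳ (element-index a)) (a-[a-b]≈b a b)))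
          (Equivalence.from (InOther⇔ disjoint) (b∈⋃ , b∉)))

      -- The dichotomy is available for nonzero `δ` only; `δ ≈ ε` would identify `b` with `a`, which
      -- lies in the `i`-th member.
      δ≉0 : ¬ δ ≈ ε
      δ≉0 δ≈0 = b∉ (∈-resp-≈ (x∙y⁻¹≈ε⇒x≈y a b δ≈0) a∈)

      -- Equal cardinalities would turn `∅ ⊆ V` into `V ⊆ ∅`, where `a` cannot lie.
      V≢∅ : ∣ V ∣ ≢ 0
      V≢∅ ∣V∣≡0 = ∉⊥ (p⊆q∧∣p∣≡∣q∣⇒q⊆p (⊥-elim ∘ ∉⊥) (trans (∣⊥∣≡0 order) (sym ∣V∣≡0)) a∈V)

      A⊆V : lookup 𝒜 i ⊆ V
      A⊆V with bimodal i δ δ≉0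
      ... | inj₁ N≡0   = ⊥-elim (V≢∅ (trans (sym (N≡∣matched∣ i δ V V⇔)) N≡0))
      ... | inj₂ N≡∣A∣ = p⊆q∧∣p∣≡∣q∣⇒q⊆p (λ {k} → proj₁ ∘ Equivalence.to (V⇔ k))
                           (trans (sym (N≡∣matched∣ i δ V V⇔)) N≡∣A∣)

    -- One matched element forces all to be matched, because stability carries its partner to a
    -- partner of any other element of the member. So `V` is empty or the whole member.
    stable⇒bimodal : PairwiseDisjoint G 𝒜 → (∀ i → Stable (⋃ 𝒜) (lookup 𝒜 i)) → Bimodal G 𝒜
    stable⇒bimodal disj stable = record { disjoint = disj ; bimodal = λ i δ _ → dichotomy i δ }
      where
      dichotomy : ∀ i δ → N G 𝒜 i δ ≡ 0 ⊎ N G 𝒜 i δ ≡ ∣ lookup 𝒜 i ∣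
      dichotomy i δ with matched i δ
      ... | V , V⇔ with nonempty? V
      ...   | no V=∅ = inj₁ (trans (N≡∣matched∣ i δ V V⇔)
                              (trans (cong ∣_∣ (Empty-unique V=∅)) (∣⊥∣≡0 order)))
      ...   | yes (k , k∈V) = inj₂ (trans (N≡∣matched∣ i δ V V⇔) (cong ∣_∣ (⊆-antisym
                (λ {l} → proj₁ ∘ Equivalence.to (V⇔ l)) A⊆V)))
        where
        a = element k
        k-matched = Equivalence.to (V⇔ k) k∈V
        a-δ∈ = Equivalence.to (InOther⇔ disj) (proj₂ k-matched)

        member : ∀ {l} → l ∈ꟳ lookup 𝒜 i → element l ∈ᴳ lookup 𝒜 i
        member {l} = subst (_∈ꟳ lookup 𝒜 i) (sym (index-element l))

        A⊆V : lookup 𝒜 i ⊆ V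
        -- Translating `a - δ` by `element l - a` gives `element l - (a - (a - δ))`, that is
        -- `element l - δ`.
        A⊆V {l} l∈A = Equivalence.from (V⇔ l) (l∈A , InOther-resp-≈
          (≈-trans (≈-sym (a′-[a-b] a (element l) (a - δ))) (-‿cong (a-[a-b]≈b a δ)))
          (Equivalence.from (InOther⇔ disj)
            (stable i (member (proj₁ k-matched)) (member l∈A) (proj₁ a-δ∈) (proj₂ a-δ∈))))

  -- Passage of stability to a subcoset.

  stable-subcoset : ∀ {W A B} → A ⊆ W → B ⊆ A →
                    IsCosetOf G A (InternalDifferenceGroup G A) →
                    IsCosetOf G B (InternalDifferenceGroup G B) →
                    Stable W A → Stable W B
  stable-subcoset {W} {A} {B} A⊆W B⊆A A-coset B-coset stable {a} {a′} {b} a∈B a′∈B b∈W b∉B =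
    inW , notInB
    where
    inW : b ⊹ (a′ - a) ∈ᴳ W
    -- Inside `A` the coset property keeps the translate in `A`, as `a′ - a` is also a difference of
    -- `A`; outside `A` the stability of `A` applies.
    inW with index b ∈ꟳ? A
    ... | yes b∈A = A⊆W (coset-absorbs A-coset b∈A
                      (generator (a′ , a , B⊆A a′∈B , B⊆A a∈B , ≈-refl)))
    ... | no  b∉A = proj₁ (stable (B⊆A a∈B) (B⊆A a′∈B) b∈W b∉A)

    notInB : ¬ b ⊹ (a′ - a) ∈ᴳ B
    -- Were the translate in `B`, translating back by the negated difference would stay in the coset
    -- `B`, yet it returns to `b`.
    notInB ∈B = b∉B (∈-resp-≈ (//-rightDividesʳ (a′ - a) b)
      (coset-absorbs B-coset ∈B (negate (generator (a′ , a , a′∈B , a∈B , ≈-refl)))))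

  -- Refining one member of a collection.

  module _ (ℬ : List (SubsetOf G)) where

    -- Recursion on `i` lets `take` and `drop` compute, so no positions in the refined list are
    -- calculated. It serves both disjointness and stability.
    All-refine : ∀ {p} {P : Pred (SubsetOf G) p} 𝒜 i → All P 𝒜 → All P ℬ →
                 All P (refine G 𝒜 i ℬ)
    All-refine (A ∷ 𝒜) zero    (_ ∷ ps) qs = Allₚ.++⁺ qs ps
    All-refine (A ∷ 𝒜) (suc i) (p ∷ ps) qs = p ∷ All-refine 𝒜 i ps qs

    ⋃-refine : ∀ 𝒜 i → ⋃ ℬ ≡ lookup 𝒜 i → ⋃ (refine G 𝒜 i ℬ) ≡ ⋃ 𝒜
    ⋃-refine (A ∷ 𝒜) zero    eq = trans (⋃-++ ℬ 𝒜) (cong (_∪ ⋃ 𝒜) eq)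
    ⋃-refine (A ∷ 𝒜) (suc i) eq = cong (A ∪_) (⋃-refine 𝒜 i eq)

    -- Each part lies in the member it replaces, so it inherits that member's disjointness from the
    -- others, whether they come after it (`zero`) or before it (`suc`).
    disjoint-refine : ∀ {𝒜} i → PairwiseDisjoint G 𝒜 → PairwiseDisjoint G ℬ →
                      ⋃ ℬ ≡ lookup 𝒜 i → PairwiseDisjoint G (refine G 𝒜 i ℬ)
    disjoint-refine zero (A∩ ∷ disj) disjℬ eq = AllPairsₚ.++⁺ disjℬ disj
      (All-fromLookup λ j → All.map (Empty-∩-monoˡ (⋃≡⇒lookup⊆ ℬ eq j)) A∩)
    disjoint-refine (suc i) (A∩ ∷ disj) disjℬ eq =
      All-refine _ i A∩ (All-fromLookup λ j → Empty-∩-monoʳ (⋃≡⇒lookup⊆ ℬ eq j) (All-lookup A∩ i))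
      ∷ disjoint-refine i disj disjℬ eq

theorem2p12 : ∀ {c ℓ} (G : FiniteAbelianGroup c ℓ)
    (𝒜 : List (SubsetOf G)) →
    Bimodal G 𝒜 →
    (i : Fin (length 𝒜)) →
    IsCosetOf G (lookup 𝒜 i) (InternalDifferenceGroup G (lookup 𝒜 i)) →
    (ℬ : List (SubsetOf G)) →
    PairwiseDisjoint G ℬ →
    ⋃ ℬ ≡ lookup 𝒜 i →
    (∀ (j : Fin (length ℬ)) → IsCosetOf G (lookup ℬ j) (InternalDifferenceGroup G (lookup ℬ j))) →
    Bimodal G (refine G 𝒜 i ℬ)
theorem2p12 G 𝒜 bim i A-coset ℬ disjℬ ⋃ℬ≡A B-coset =
  stable⇒bimodal G (disjoint-refine G ℬ i (Bimodal.disjoint bim) disjℬ ⋃ℬ≡A)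
    -- Stability of old members and of parts is shown relative to `⋃ 𝒜`, then transported along the
    -- equality of the two unions.
    (All-lookup (subst (λ W → All (Stable G W) (refine G 𝒜 i ℬ)) (sym (⋃-refine G ℬ 𝒜 i ⋃ℬ≡A))
      (All-refine G ℬ 𝒜 i (All-fromLookup stable) (All-fromLookup stable-part))))
  where
  stable : ∀ j → Stable G (⋃ 𝒜) (lookup 𝒜 j)
  stable = bimodal⇒stable G bim

  stable-part : ∀ j → Stable G (⋃ 𝒜) (lookup ℬ j)
  stable-part j = stable-subcoset G (∈⋃⁺ 𝒜 i) (⋃≡⇒lookup⊆ ℬ ⋃ℬ≡A j) A-coset (B-coset j)
                    (stable i)
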